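{- Let $n\ge 3$ be an integer, let $\gamma=0$ if $n$ is even and $\gamma=1$ if $n$ is odd, and let $H_n^4$ be any graph in $\mathscr{H}_n^4$. Then for every integer $h$ with $1\le h\le 2^{\lceil n/2\rceil}-2-\gamma$, $$\lambda_h(H_n^4)=\xi_h(H_n^4).$$
   Context: The family $\mathscr{H}_n^4$ ($n\ge 2$) of $n$-dimensional $K_4$-hypercubes is defined recursively: $\mathscr{H}_2^4=\{K_4\}$; for $n\ge 3$, a graph belongs to $\mathscr{H}_n^4$ if and only if (up to isomorphism) it is obtained from two vertex-disjoint graphs $G_0,G_1\in\mathscr{H}_{n-1}^4$ (not necessarily isomorphic) by adding an arbitrary perfect matching between $V(G_0)$ and $V(G_1)$. Each member of $\mathscr{H}_n^4$ is $(n+1)$-regular with $2^n$ vertices. For a graph $G$ and $X\subseteq V(G)$, $\overline{X}=V(G)\setminus X$ and $[X,\overline{X}]$ is the set of edges with exactly one end in $X$. For $1\le m\le\lfloor |V(G)|/2\rfloor$, $\xi_m(G)=\min\{|[X,\overline{X}]| : |X|=m,\ G[X]\text{ and }G[\overline{X}]\text{ both connected}\}$. For a connected graph $G$ and integer $h\ge1$, the $h$-extra edge-connectivity $\lambda_h(G)$ is the minimum size of an edge set $F\subseteq E(G)$ such that $G-F$ is disconnected and every component of $G-F$ has at least $h$ vertices. -}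

module Defs where

open import Data.Nat using (ℕ; zero; suc; _+_; _≤_; _<_)
open import Data.Fin using (Fin; toℕ; splitAt)
open import Data.Fin.Properties using (_≟_)
open import Data.Fin.Subset using (Subset; _∈_; _∉_; ∣_∣; ∁)
open import Data.Bool using (Bool; true; false; _∧_; not; if_then_else_)
open import Data.Sum using (_⊎_; inj₁; inj₂)
open import Data.Product using (Σ; _×_; ∃; _,_)
open import Data.List using (List; map; allFin)
open import Data.Nat.ListAction using (sum)
open import Data.Empty using (⊥)
open import Relation.Nullary using (¬_)
open import Relation.Nullary.Decidable using (⌊_⌋)
open import Relation.Binary.PropositionalEquality using (_≡_)
open import Function.Bundles using (_⤖_; Bijection)
open import Function.Definitions using (Injective)

-- A (finite) graph: vertex set Fin V, Boolean adjacency.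
-- (Simplicity of all graphs in the family follows from the definition below.)
record Graph : Set where
  constructor mkGraph
  field
    V   : ℕ
    adj : Fin V → Fin V → Bool
open Graph public

_≅_ : Graph → Graph → Set
G ≅ H = Σ (Fin (V G) ⤖ Fin (V H)) λ f →
          ∀ u v → adj G u v ≡ adj H (Bijection.to f u) (Bijection.to f v)

K4 : Graph
K4 = mkGraph 4 (λ u v → not ⌊ u ≟ v ⌋)

matchJoin : (G0 G1 : Graph) → Fin (V G0) ⤖ Fin (V G1) → Graph
matchJoin G0 G1 π = mkGraph (V G0 + V G1) A
  where
  to = Bijection.to π
  A' : Fin (V G0) ⊎ Fin (V G1) → Fin (V G0) ⊎ Fin (V G1) → Bool
  A' (inj₁ a) (inj₁ b) = adj G0 a b
  A' (inj₂ a) (inj₂ b) = adj G1 a b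
  A' (inj₁ a) (inj₂ b) = ⌊ to a ≟ b ⌋
  A' (inj₂ b) (inj₁ a) = ⌊ to a ≟ b ⌋
  A : Fin (V G0 + V G1) → Fin (V G0 + V G1) → Bool
  A u v = A' (splitAt (V G0) u) (splitAt (V G0) v)

data K4Hypercube : ℕ → Graph → Set where
  base : ∀ {G} → G ≅ K4 → K4Hypercube 2 G
  step : ∀ {n G} (G0 G1 : Graph) →
         K4Hypercube (suc n) G0 → K4Hypercube (suc n) G1 →
         (π : Fin (V G0) ⤖ Fin (V G1)) →
         G ≅ matchJoin G0 G1 π → K4Hypercube (suc (suc n)) G

data Reach {N : ℕ} (A : Fin N → Fin N → Set) : Fin N → Fin N → Set where
  here  : ∀ {u} → Reach A u u
  there : ∀ {u w v} → A u w → Reach A w v → Reach A u v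

-- G[X] is connected (X is nonempty in all uses).
InducedConnected : (G : Graph) → Subset (V G) → Set
InducedConnected G X = ∀ u v → u ∈ X → v ∈ X →
  Reach (λ a b → a ∈ X × b ∈ X × adj G a b ≡ true) u v

complement : ∀ {N} → Subset N → Subset N
complement = ∁

inB : ∀ {N} → Fin N → Subset N → Bool
inB u X = Data.Vec.lookup X u
  where import Data.Vec

cutSize : (G : Graph) → Subset (V G) → ℕ
cutSize G X = sum (map (λ u → sum (map (λ v →
  if inB u X ∧ not (inB v X) ∧ adj G u v then 1 else 0) (allFin (V G)))) (allFin (V G)))

IsXi : (G : Graph) → ℕ → ℕ → Set
IsXi G m k =
  (Σ (Subset (V G)) λ X → ∣ X ∣ ≡ m × InducedConnected G X ×
      InducedConnected G (complement X) × cutSize G X ≡ k)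
  × (∀ (X : Subset (V G)) → ∣ X ∣ ≡ m → InducedConnected G X →
      InducedConnected G (complement X) → k ≤ cutSize G X)

record EdgeSet (G : Graph) : Set where
  field
    mem  : Fin (V G) → Fin (V G) → Bool
    sym  : ∀ u v → mem u v ≡ mem v u
    sub  : ∀ u v → mem u v ≡ true → adj G u v ≡ true
open EdgeSet public

edgeSetSize : {G : Graph} → EdgeSet G → ℕ
edgeSetSize {G} F = sum (map (λ u → sum (map (λ v →
  if ⌊ toℕ u Data.Nat.<? toℕ v ⌋ ∧ mem F u v then 1 else 0)
    (allFin (V G)))) (allFin (V G)))

RemAdj : (G : Graph) → EdgeSet G → Fin (V G) → Fin (V G) → Set
RemAdj G F u v = adj G u v ∧ not (mem F u v) ≡ true

IsExtraCut : (h : ℕ) (G : Graph) → EdgeSet G → Set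
IsExtraCut h G F =
  (Σ (Fin (V G)) λ u → Σ (Fin (V G)) λ v → ¬ Reach (RemAdj G F) u v)
  × (∀ v → Σ (Fin h → Fin (V G)) λ g →
       Injective _≡_ _≡_ g × (∀ i → Reach (RemAdj G F) v (g i)))

IsLambda : (G : Graph) → ℕ → ℕ → Set
IsLambda G h k =
  (Σ (EdgeSet G) λ F → IsExtraCut h G F × edgeSetSize F ≡ k)
  × (∀ (F : EdgeSet G) → IsExtraCut h G F → k ≤ edgeSetSize F)

{-# OPTIONS --safe #-}

-- Let θ n m be the minimum of |[X, X̄]| over the m-sets X of an n-dimensional K₄-hypercube. Splitting
-- X between the two halves into sets of sizes a and b costs at least |a − b| matching edges, and
-- θ (n + 1) (a + b) ≤ θ n a + θ n b + |a − b|, so the minimum does not depend on the matchings. It is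
-- attained inside one half (or as the complement of such a set), where both X and X̄ are connected;
-- hence ξ_h = θ n h, and the boundary of such an X is an h-extra cut. Conversely an h-extra cut F
-- contains the boundary of a component, which or whose complement has a size m with
-- h ≤ m ≤ 2^(n − 1), and θ n h ≤ θ n m there: with s = ⌈n/2⌉, θ n is nondecreasing on [0, 2^s − 1],
-- is at least θ n (2^s) on [2^s, 2^(n − 1)], and θ n (2^s − 2 − γ) ≤ θ n (2^s).

module Submission where

open import Defs hiding (sym)
open import Data.Bool using (Bool; true; false; if_then_else_; _∧_; not; _xor_)
open import Data.Bool.Properties using (∧-assoc; ∧-identityʳ; ∧-zeroʳ; ∧-inverseʳ; not-involutive; xor-comm)
import Data.Bool as Bool
open import Data.Fin using (Fin; zero; suc; toℕ; fromℕ<; inject≤; join; splitAt; _↑ˡ_; _↑ʳ_)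
open import Data.Fin.Permutation using (Permutation; _⟨$⟩ʳ_; _⟨$⟩ˡ_; inverseˡ; inverseʳ; ↔⇒≡)
open import Data.Fin.Properties using (_≟_; all?; sequence; toℕ-fromℕ<; toℕ-injective; suc-injective; injective⇒≤; inject≤-injective; splitAt-↑ˡ; splitAt-↑ʳ; join-splitAt)
open import Data.Fin.Subset using (Subset; _∈_; ∣_∣; ∁)
open import Data.List using (map; allFin)
open import Data.List.Properties using (map-tabulate)
open import Data.Nat hiding (_≟_)
import Data.Nat as ℕ
open import Data.Nat.DivMod using (m*n%n≡0; [m+kn]%n≡m%n)
open import Data.Nat.ListAction using () renaming (sum to sumᴸ)
open import Data.Nat.Properties hiding (_≟_; suc-injective)
open import Data.Nat.Tactic.RingSolver using (solve-∀)
open import Data.Product using (Σ; ∃; _×_; _,_; proj₁; proj₂)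
open import Data.Sum using (_⊎_; inj₁; inj₂; [_,_]′)
open import Data.Vec using (lookup; tabulate; []; _∷_)
open import Data.Vec.Properties using (lookup∘tabulate; lookup-map; []=⇒lookup; lookup⇒[]=)
open import Effect.Monad using (RawMonad)
open import Function using (_∘_; id; const; _⤖_)
open import Function.Definitions using (Injective)
open import Function.Properties.Bijection using (⤖⇒↔)
open import Relation.Binary.PropositionalEquality hiding (J)
open import Relation.Nullary using (¬_; Dec; yes; no; does; contradiction)
open import Relation.Nullary.Decidable using (⌊_⌋; isYes≗does; toWitness; dec-true; dec-false; ¬¬-excluded-middle; decidable-stable)
open import Relation.Nullary.Negation using (¬¬-Monad)
open import Algebra.Properties.CommutativeMonoid.Sum +-0-commutativeMonoid using (sum; sum-cong-≗; ∑-distrib-+; ∑-comm; sum-permute; sum-replicate-zero)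

-- The isoperimetric function

cube : ℕ → ℕ
cube zero    = 4
cube (suc k) = cube k + cube k

-- Dimensions are shifted by 2, the dimension of K₄: θ k m is for (k + 2)-dimensional graphs, of
-- order cube k. An extremal set lies in one half, or contains one half.
θ : ℕ → ℕ → ℕ
θ zero    m = m * (4 ∸ m)
θ (suc k) m = if m ≤ᵇ cube k then θ k m + m else θ k (m ∸ cube k) + (cube (suc k) ∸ m)

cube>0 : ∀ k → 0 < cube k
cube>0 zero    = s≤s z≤n
cube>0 (suc k) = <-≤-trans (cube>0 k) (m≤m+n (cube k) (cube k))

θ-low : ∀ k {m} → m ≤ cube k → θ (suc k) m ≡ θ k m + m
θ-low k {m} m≤ with m ≤ᵇ cube k in eq
... | true  = refl
... | false = contradiction (subst Bool.T eq (≤⇒≤ᵇ m≤)) λ ()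

θ-zero : ∀ k → θ k 0 ≡ 0
θ-zero zero    = refl
θ-zero (suc k) = trans (θ-low k z≤n) (trans (+-identityʳ _) (θ-zero k))

θ-high⁺ : ∀ k {r r'} → r + r' ≡ cube k → 0 < r → θ (suc k) (cube k + r) ≡ θ k r + r'
θ-high⁺ k {r} {r'} eq 0<r with (cube k + r) ≤ᵇ cube k in eqb
... | true  = contradiction (≤ᵇ⇒≤ _ _ (subst Bool.T (sym eqb) _))
                (<⇒≱ (m<m+n (cube k) 0<r))
... | false = cong₂ _+_ (cong (θ k) (m+n∸m≡n (cube k) r))
                (trans ([m+n]∸[m+o]≡n∸o (cube k) (cube k) r)
                       (trans (cong (_∸ r) (sym eq)) (m+n∸m≡n r r')))

θ-full : ∀ k → θ k (cube k) ≡ 0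
θ-full zero    = refl
θ-full (suc k) = trans (θ-high⁺ k (+-identityʳ _) (cube>0 k)) (trans (+-identityʳ _) (θ-full k))

-- Unlike `θ-high⁺` this includes `r = 0`, where the definition takes its lower branch: the two
-- branches agree at `cube k`, since `θ k` vanishes at both the empty and the full set.
θ-high : ∀ k {r r'} → r + r' ≡ cube k → θ (suc k) (cube k + r) ≡ θ k r + r'
θ-high k {suc r}       eq   = θ-high⁺ k eq (s≤s z≤n)
θ-high k {zero}  {r'} refl = begin
  θ (suc k) (cube k + 0) ≡⟨ cong (θ (suc k)) (+-identityʳ _) ⟩
  θ (suc k) (cube k)     ≡⟨ θ-low k ≤-refl ⟩
  θ k (cube k) + cube k  ≡⟨ cong (_+ cube k) (trans (θ-full k) (sym (θ-zero k))) ⟩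
  θ k 0 + cube k         ∎
  where open ≡-Reasoning

-- Of two complementary sizes one is at most the half `T`; writing the other as `T + r` matches the
-- two branches of `θ`.
split-sum : ∀ {m m' T} → m + m' ≡ T + T →
  (∃ λ r → m + r ≡ T × m' ≡ T + r) ⊎ (∃ λ r → m' + r ≡ T × m ≡ T + r)
split-sum {m} {m'} {T} eq with ≤-total m T
... | inj₁ m≤T = inj₁ (T ∸ m , m+[n∸m]≡n m≤T , +-cancelˡ-≡ m m' _ (begin
  m + m'            ≡⟨ eq ⟩
  T + T             ≡⟨ cong (T +_) (m+[n∸m]≡n m≤T) ⟨
  T + (m + (T ∸ m)) ≡⟨ swap T m (T ∸ m) ⟩
  m + (T + (T ∸ m)) ∎))
  where
  open ≡-Reasoning
  swap : ∀ x y z → x + (y + z) ≡ y + (x + z)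
  swap = solve-∀
... | inj₂ T≤m = inj₂ (m ∸ T , +-cancelˡ-≡ T _ _ (begin
  T + (m' + (m ∸ T)) ≡⟨ rotate T m' (m ∸ T) ⟩
  T + (m ∸ T) + m'   ≡⟨ cong (_+ m') (m+[n∸m]≡n T≤m) ⟩
  m + m'             ≡⟨ eq ⟩
  T + T              ∎) , sym (m+[n∸m]≡n T≤m))
  where
  open ≡-Reasoning
  rotate : ∀ x y z → x + (y + z) ≡ x + z + y
  rotate = solve-∀

-- The lower branch at `m` and the upper branch at `cube k + r`, with `m + r = cube k`, differ only
-- in `θ k m` against `θ k r`, which agree by induction.
θ-sym : ∀ k {m m'} → m + m' ≡ cube k → θ k m ≡ θ k m'
θ-sym zero {0} refl = refl
θ-sym zero {1} refl = refl
θ-sym zero {2} refl = refl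
θ-sym zero {3} refl = refl
θ-sym zero {4} refl = refl
θ-sym zero {suc (suc (suc (suc (suc m))))} ()
θ-sym (suc k) {m} {m'} eq with split-sum {m} {T = cube k} eq
... | inj₁ (r , m+r , refl) = begin
  θ (suc k) m            ≡⟨ θ-low k (m+n≤o⇒m≤o m (≤-reflexive m+r)) ⟩
  θ k m + m              ≡⟨ cong (_+ m) (θ-sym k m+r) ⟩
  θ k r + m              ≡⟨ θ-high k (trans (+-comm r m) m+r) ⟨
  θ (suc k) (cube k + r) ∎
  where open ≡-Reasoning
... | inj₂ (r , m'+r , refl) = begin
  θ (suc k) (cube k + r) ≡⟨ θ-high k (trans (+-comm r m') m'+r) ⟩
  θ k r + m'             ≡⟨ cong (_+ m') (θ-sym k m'+r) ⟨
  θ k m' + m'            ≡⟨ θ-low k (m+n≤o⇒m≤o m' (≤-reflexive m'+r)) ⟨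
  θ (suc k) m'           ∎
  where open ≡-Reasoning

∣-∣-complement : ∀ {a a' b b' T} → a + a' ≡ T → b + b' ≡ T → ∣ a - b ∣ ≡ ∣ a' - b' ∣
∣-∣-complement {a} {a'} {b} {b'} ea eb = begin
  ∣ a - b ∣           ≡⟨ ∣m+n-m+o∣≡∣n-o∣ a' a b ⟨
  ∣ a' + a - a' + b ∣ ≡⟨ cong₂ ∣_-_∣ (trans (+-comm a' a) (trans ea (sym eb))) (+-comm a' b) ⟩
  ∣ b + b' - b + a' ∣ ≡⟨ ∣m+n-m+o∣≡∣n-o∣ b b' a' ⟩
  ∣ b' - a' ∣         ≡⟨ ∣-∣-comm b' a' ⟩
  ∣ a' - b' ∣         ∎
  where open ≡-Reasoning

∣m-n∣≤m+n : ∀ m n → ∣ m - n ∣ ≤ m + n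
∣m-n∣≤m+n m n = ≤-trans (∣m-n∣≤m⊔n m n) (m⊔n≤m+n m n)

-- The inequality for a set split between two halves

θ-Join : ℕ → Set
θ-Join k = ∀ {a b} → a ≤ cube k → b ≤ cube k → θ (suc k) (a + b) ≤ θ k a + θ k b + ∣ a - b ∣

θ-join-zero : θ-Join zero
θ-join-zero {a} {b} a≤ b≤ = subst₂ (λ x y → θ 1 (x + y) ≤ θ 0 x + θ 0 y + ∣ x - y ∣)
    (toℕ-fromℕ< (s≤s a≤)) (toℕ-fromℕ< (s≤s b≤))
    -- Both sizes are at most 4, so the claim is one of 25 numerical inequalities, settled by
    -- evaluation.
    (check (fromℕ< (s≤s a≤)) (fromℕ< (s≤s b≤)))
  where
  check : (a b : Fin 5) → θ 1 (toℕ a + toℕ b) ≤ θ 0 (toℕ a) + θ 0 (toℕ b) + ∣ toℕ a - toℕ b ∣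
  check = toWitness {a? = all? λ a → all? λ b → _ ≤? _} _

-- While `a + b` fits into one half, the left side of the join inequality carries an extra `a + b`,
-- which outweighs the imbalance `∣ a - b ∣` on the right.
θ-subadditive : ∀ k → θ-Join k → ∀ {a b} → a + b ≤ cube k → θ k (a + b) ≤ θ k a + θ k b
θ-subadditive k join {a} {b} ab≤ = +-cancelʳ-≤ (a + b) _ _ (begin
  θ k (a + b) + (a + b)         ≡⟨ θ-low k ab≤ ⟨
  θ (suc k) (a + b)             ≤⟨ join (m+n≤o⇒m≤o a ab≤) (m+n≤o⇒n≤o a ab≤) ⟩
  θ k a + θ k b + ∣ a - b ∣     ≤⟨ +-monoʳ-≤ (θ k a + θ k b) (∣m-n∣≤m+n a b) ⟩
  θ k a + θ k b + (a + b)       ∎)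
  where open ≤-Reasoning

-- If `a` fits into a half, all three values unfold by the lower branch and the induction hypothesis
-- suffices. Otherwise only `a` and `a + b` reach the upper branch, and subadditivity of `θ k`
-- compares what exceeds `cube k`.
θ-join-small : ∀ k → θ-Join k → ∀ {a b} → b ≤ a → a + b ≤ cube (suc k) →
  θ (suc (suc k)) (a + b) ≤ θ (suc k) a + θ (suc k) b + ∣ a - b ∣
θ-join-small k join {a} {b} b≤a ab≤ with ≤-total a (cube k)
... | inj₁ a≤ = begin
  θ (2 + k) (a + b)                         ≡⟨ θ-low (suc k) ab≤ ⟩
  θ (suc k) (a + b) + (a + b)               ≤⟨ +-monoˡ-≤ (a + b) (join a≤ (≤-trans b≤a a≤)) ⟩
  θ k a + θ k b + ∣ a - b ∣ + (a + b)       ≡⟨ regroup (θ k a) (θ k b) a b ∣ a - b ∣ ⟩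
  (θ k a + a) + (θ k b + b) + ∣ a - b ∣
    ≡⟨ cong (_+ ∣ a - b ∣) (cong₂ _+_ (θ-low k a≤) (θ-low k (≤-trans b≤a a≤))) ⟨
  θ (suc k) a + θ (suc k) b + ∣ a - b ∣     ∎
  where
  open ≤-Reasoning
  regroup : ∀ x y a b d → x + y + d + (a + b) ≡ (x + a) + (y + b) + d
  regroup = solve-∀
... | inj₂ T≤a = large (a ∸ cube k) (cube k ∸ (a ∸ cube k + b)) (sym (m+[n∸m]≡n T≤a)) (m+[n∸m]≡n slack)
  where
  open ≤-Reasoning
  slack : a ∸ cube k + b ≤ cube k
  slack = +-cancelˡ-≤ (cube k) _ _ (begin
    cube k + (a ∸ cube k + b) ≡⟨ +-assoc (cube k) _ b ⟨
    cube k + (a ∸ cube k) + b ≡⟨ cong (_+ b) (m+[n∸m]≡n T≤a) ⟩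
    a + b                     ≤⟨ ab≤ ⟩
    cube k + cube k           ∎)
  -- `c` is the excess of `a` over one half and `d` the room that `c` and `b` leave in the other;
  -- rewriting `cube k` as `c + b + d` makes both sides linear in `b`, `c`, `d`.
  large : ∀ c d → a ≡ cube k + c → c + b + d ≡ cube k →
    θ (suc (suc k)) (a + b) ≤ θ (suc k) a + θ (suc k) b + ∣ a - b ∣
  large c d refl cbd = begin
    θ (2 + k) (cube k + c + b)                       ≡⟨ θ-low (suc k) ab≤ ⟩
    θ (suc k) (cube k + c + b) + (cube k + c + b)    ≡⟨ cong (λ x → θ (suc k) x + x) (+-assoc (cube k) c b) ⟩
    θ (suc k) (cube k + (c + b)) + (cube k + (c + b)) ≡⟨ cong (_+ (cube k + (c + b))) (θ-high k cbd) ⟩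
    θ k (c + b) + d + (cube k + (c + b))             ≤⟨ +-monoˡ-≤ _ (+-monoˡ-≤ d (θ-subadditive k join cb≤)) ⟩
    θ k c + θ k b + d + (cube k + (c + b))           ≡⟨ cong (λ z → θ k c + θ k b + d + (z + (c + b))) cbd ⟨
    θ k c + θ k b + d + (c + b + d + (c + b))        ≡⟨ regroup (θ k c) (θ k b) b c d ⟩
    θ k c + (b + d) + (θ k b + b) + (c + d + c)      ≡⟨ cong₂ _+_ (cong₂ _+_ (θ-high k c+) (θ-low k b≤)) dist ⟨
    θ (suc k) (cube k + c) + θ (suc k) b + ∣ cube k + c - b ∣ ∎
    where
    c+ : c + (b + d) ≡ cube k
    c+ = trans (sym (+-assoc c b d)) cbd
    cb≤ : c + b ≤ cube k
    cb≤ = m+n≤o⇒m≤o (c + b) (≤-reflexive cbd)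
    b≤ : b ≤ cube k
    b≤ = m+n≤o⇒n≤o c cb≤
    regroup : ∀ x y b c d → x + y + d + (c + b + d + (c + b)) ≡ x + (b + d) + (y + b) + (c + d + c)
    regroup = solve-∀
    shift : ∀ b c d → c + b + d + c ≡ b + (c + d + c)
    shift = solve-∀
    dist : ∣ cube k + c - b ∣ ≡ c + d + c
    dist = trans (∣-∣-comm (cube k + c) b)
      (trans (cong (∣ b -_∣) (trans (cong (_+ c) (sym cbd)) (shift b c d))) (∣m-m+n∣≡n b _))

-- Both sides are unchanged when `a` and `b` are replaced by their complements in the halves, and
-- when they are exchanged; so `b ≤ a` and `a + b ≤ T` may be assumed.
θ-join : ∀ k → θ-Join k
θ-join zero = θ-join-zero
θ-join (suc k) {a} {b} a≤ b≤ = by-complement (m+[n∸m]≡n a≤) (m+[n∸m]≡n b≤)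
  where
  open ≤-Reasoning
  T = cube (suc k)
  small : ∀ {a b} → a + b ≤ T → θ (2 + k) (a + b) ≤ θ (suc k) a + θ (suc k) b + ∣ a - b ∣
  small {a} {b} ab≤ with ≤-total b a
  ... | inj₁ b≤a = θ-join-small k (θ-join k) b≤a ab≤
  ... | inj₂ a≤b = begin
    θ (2 + k) (a + b)                     ≡⟨ cong (θ (2 + k)) (+-comm a b) ⟩
    θ (2 + k) (b + a)                     ≤⟨ θ-join-small k (θ-join k) a≤b (subst (_≤ T) (+-comm a b) ab≤) ⟩
    θ (suc k) b + θ (suc k) a + ∣ b - a ∣ ≡⟨ cong₂ _+_ (+-comm (θ (suc k) b) _) (∣-∣-comm b a) ⟩
    θ (suc k) a + θ (suc k) b + ∣ a - b ∣ ∎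
  regroup : ∀ a b a' b' → a + b + (a' + b') ≡ a + a' + (b + b')
  regroup = solve-∀
  total : ∀ {a' b'} → a + a' ≡ T → b + b' ≡ T → a + b + (a' + b') ≡ T + T
  total {a'} {b'} ea eb = trans (regroup a b a' b') (cong₂ _+_ ea eb)
  by-complement : ∀ {a' b'} → a + a' ≡ T → b + b' ≡ T →
    θ (2 + k) (a + b) ≤ θ (suc k) a + θ (suc k) b + ∣ a - b ∣
  by-complement {a'} {b'} ea eb with split-sum {a + b} {T = T} (total ea eb)
  ... | inj₁ (r , ab , _) = small {a} {b} (m+n≤o⇒m≤o (a + b) (≤-reflexive ab))
  ... | inj₂ (r , ab' , _) = begin
    θ (2 + k) (a + b)                         ≡⟨ θ-sym (2 + k) {a + b} (total ea eb) ⟩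
    θ (2 + k) (a' + b')                       ≤⟨ small {a'} {b'} (m+n≤o⇒m≤o (a' + b') (≤-reflexive ab')) ⟩
    θ (suc k) a' + θ (suc k) b' + ∣ a' - b' ∣
      ≡⟨ cong₂ _+_ (cong₂ _+_ (θ-sym (suc k) {a} ea) (θ-sym (suc k) {b} eb)) (∣-∣-complement {a} {a'} {b} ea eb) ⟨
    θ (suc k) a + θ (suc k) b + ∣ a - b ∣     ∎

-- The bound is the value of `θ` at `m = cube t`. If `m` fits into the next smaller half, the outer
-- matching adds `m ≥ cube t` to the inductive bound; otherwise the matchings of the two outermost
-- levels alone contribute twice `cube (j + t)`.
θ-large : ∀ t j {m} → cube t ≤ m → m ≤ cube (j + t) → suc j * cube t ≤ θ (suc (j + t)) m
θ-large t zero {m} lo hi = begin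
  1 * cube t      ≡⟨ *-identityˡ _ ⟩
  cube t          ≤⟨ lo ⟩
  m               ≤⟨ m≤n+m m (θ t m) ⟩
  θ t m + m       ≡⟨ θ-low t hi ⟨
  θ (suc t) m     ∎
  where open ≤-Reasoning
θ-large t (suc j) {m} lo hi with ≤-total m (cube (j + t))
... | inj₁ m≤ = begin
  cube t + suc j * cube t         ≤⟨ +-mono-≤ lo (θ-large t j lo m≤) ⟩
  m + θ (suc (j + t)) m           ≡⟨ +-comm m _ ⟩
  θ (suc (j + t)) m + m           ≡⟨ θ-low (suc (j + t)) hi ⟨
  θ (2 + j + t) m                 ∎
  where open ≤-Reasoning
... | inj₂ T≤m = upper (m ∸ T) (T ∸ (m ∸ T)) (m+[n∸m]≡n T≤m)
    (m+[n∸m]≡n (+-cancelˡ-≤ T _ _ (subst (_≤ T + T) (sym (m+[n∸m]≡n T≤m)) hi)))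
  where
  open ≤-Reasoning
  T = cube (j + t)
  -- The bound is linear in `j` while the order doubles: `j + 2 ≤ 2 ^ (j + 1)`.
  grow : ∀ j → suc (suc j) * cube t ≤ cube (j + t) + cube (j + t)
  grow zero    = ≤-reflexive (cong (cube t +_) (+-identityʳ _))
  grow (suc j) = begin
    cube t + suc (suc j) * cube t          ≤⟨ +-mono-≤ (≤-trans (m≤m+n (cube t) _) (grow j)) (grow j) ⟩
    cube (suc j + t) + cube (suc j + t)    ∎
  upper : ∀ r r' → T + r ≡ m → r + r' ≡ T → suc (suc j) * cube t ≤ θ (2 + j + t) m
  upper r r' refl rr' = begin
    suc (suc j) * cube t           ≤⟨ grow j ⟩
    T + T                          ≡⟨ cong (T +_) rr' ⟨
    T + (r + r')                   ≤⟨ m≤n+m _ (θ (j + t) r) ⟩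
    θ (j + t) r + (T + (r + r'))   ≡⟨ regroup (θ (j + t) r) T r r' ⟩
    θ (j + t) r + r' + (T + r)     ≡⟨ cong (_+ (T + r)) (θ-high (j + t) rr') ⟨
    θ (suc (j + t)) (T + r) + (T + r) ≡⟨ θ-low (suc (j + t)) hi ⟨
    θ (2 + j + t) (T + r)          ∎
    where
    regroup : ∀ x y r r' → x + (y + (r + r')) ≡ x + r' + (y + r)
    regroup = solve-∀

-- A vertex has degree `3 + k`, so adding one to a set cannot lose more edges than that. The full
-- loss is needed only for the last vertex; before it, `θ-drop′` saves 2. The two are proved
-- together, each call of `θ-drop` from `θ-drop′` being one dimension lower.
θ-drop : ∀ k {m} → m < cube k → θ k m ≤ θ k (suc m) + (3 + k)
θ-drop′ : ∀ k {m} → suc m < cube k → θ k m ≤ θ k (suc m) + (1 + k)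

θ-drop k {m} m< with suc m ℕ.≟ cube k
... | no  ≢T = ≤-trans (θ-drop′ k (≤∧≢⇒< m< ≢T)) (+-monoʳ-≤ (θ k (suc m)) (m≤n+m (1 + k) 2))
-- Here `m` misses a single vertex, so `θ k m = θ k 1`, at most the degree.
... | yes ≡T = ≤-trans (≤-trans (≤-reflexive (θ-sym k {m} {1} (trans (+-comm m 1) ≡T))) (θ-one k)) (m≤n+m _ (θ k (suc m)))
  where
  θ-one : ∀ k → θ k 1 ≤ 3 + k
  θ-one zero    = ≤-refl
  θ-one (suc k) = begin
    θ (suc k) 1 ≡⟨ θ-low k (cube>0 k) ⟩
    θ k 1 + 1   ≤⟨ +-monoˡ-≤ 1 (θ-one k) ⟩
    3 + k + 1   ≡⟨ +-comm (3 + k) 1 ⟩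
    4 + k       ∎
    where open ≤-Reasoning

θ-drop′ zero {0} m< = z≤n
θ-drop′ zero {1} m< = m≤m+n 3 2
θ-drop′ zero {2} m< = ≤-refl
θ-drop′ zero {suc (suc (suc m))} (s≤s (s≤s (s≤s (s≤s ()))))
θ-drop′ (suc k) {m} m< with suc m ≤? cube k
... | yes m<T = begin
  θ (suc k) m                       ≡⟨ θ-low k (<⇒≤ m<T) ⟩
  -- The added vertex may complete the lower half and lose all `3 + k` edges there, but it gains its
  -- matching edge.
  θ k m + m                         ≤⟨ +-monoˡ-≤ m (θ-drop k m<T) ⟩
  θ k (suc m) + (3 + k) + m         ≡⟨ regroup (θ k (suc m)) k m ⟩
  θ k (suc m) + suc m + (2 + k)     ≡⟨ cong (_+ (2 + k)) (θ-low k m<T) ⟨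
  θ (suc k) (suc m) + (2 + k)       ∎
  where
  open ≤-Reasoning
  regroup : ∀ x k m → x + (3 + k) + m ≡ x + suc m + (2 + k)
  regroup = solve-∀
... | no m≮T = upper (m ∸ cube k) (cube k ∸ suc (m ∸ cube k)) (m+[n∸m]≡n T≤m) (m+[n∸m]≡n (<⇒≤ r<))
  where
  open ≤-Reasoning
  T≤m : cube k ≤ m
  T≤m = s≤s⁻¹ (≰⇒> m≮T)
  r< : suc (m ∸ cube k) < cube k
  r< = +-cancelˡ-< (cube k) _ _ (subst (_< cube (suc k))
    (trans (cong suc (sym (m+[n∸m]≡n T≤m))) (sym (+-suc (cube k) _))) m<)
  upper : ∀ r r' → cube k + r ≡ m → suc r + r' ≡ cube k → θ (suc k) m ≤ θ (suc k) (suc m) + (2 + k)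
  upper r r' refl rr' = begin
    θ (suc k) (cube k + r)            ≡⟨ θ-high k (trans (+-suc r r') rr') ⟩
    -- In the upper half the added vertex loses its matching edge as well: `r'` counts the matching
    -- edges that still leave the set.
    θ k r + suc r'                    ≤⟨ +-monoˡ-≤ (suc r') (θ-drop′ k (subst (λ x → suc x < cube k) (m+n∸m≡n (cube k) r) r<)) ⟩
    θ k (suc r) + (1 + k) + suc r'    ≡⟨ regroup (θ k (suc r)) k r' ⟩
    θ k (suc r) + r' + (2 + k)        ≡⟨ cong (_+ (2 + k)) (θ-high k rr') ⟨
    θ (suc k) (cube k + suc r) + (2 + k) ≡⟨ cong (λ x → θ (suc k) x + (2 + k)) (+-suc (cube k) r) ⟩
    θ (suc k) (suc (cube k + r)) + (2 + k) ∎
    where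
    regroup : ∀ x k r → x + (1 + k) + suc r ≡ x + r + (2 + k)
    regroup = solve-∀

cube-mono : ∀ j k → cube k ≤ cube (j + k)
cube-mono zero    k = ≤-refl
cube-mono (suc j) k = ≤-trans (cube-mono j k) (m≤m+n _ _)

-- Each of the `j` outer matchings contributes one edge per vertex of the set.
θ-scale : ∀ j k {m} → m ≤ cube k → θ (j + k) m ≡ θ k m + j * m
θ-scale zero    k m≤ = sym (+-identityʳ _)
θ-scale (suc j) k {m} m≤ = begin
  θ (suc j + k) m        ≡⟨ θ-low (j + k) (≤-trans m≤ (cube-mono j k)) ⟩
  θ (j + k) m + m        ≡⟨ cong (_+ m) (θ-scale j k m≤) ⟩
  θ k m + j * m + m      ≡⟨ +-assoc (θ k m) (j * m) m ⟩
  θ k m + (j * m + m)    ≡⟨ cong (θ k m +_) (+-comm (j * m) m) ⟩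
  θ k m + suc j * m      ∎
  where open ≡-Reasoning

-- Adding a vertex loses at most `1 + k` edges in the inner part by `θ-drop′`, and gains one edge in
-- each of the `j` outer matchings.
θ-mono-small : ∀ {j k} → suc k ≤ j → ∀ {h m} → h ≤ m → m < cube k → θ (j + k) h ≤ θ (j + k) m
θ-mono-small {j} {k} k<j h≤m m<T = go (≤⇒≤′ h≤m) m<T
  where
  open ≤-Reasoning
  increment : ∀ {m} → suc m < cube k → θ (j + k) m ≤ θ (j + k) (suc m)
  increment {m} m< = begin
    θ (j + k) m                       ≡⟨ θ-scale j k (<⇒≤ (<-trans (n<1+n m) m<)) ⟩
    θ k m + j * m                     ≤⟨ +-monoˡ-≤ (j * m) (θ-drop′ k m<) ⟩
    θ k (suc m) + (1 + k) + j * m     ≤⟨ +-monoˡ-≤ (j * m) (+-monoʳ-≤ (θ k (suc m)) k<j) ⟩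
    θ k (suc m) + j + j * m           ≡⟨ +-assoc (θ k (suc m)) j (j * m) ⟩
    θ k (suc m) + (j + j * m)         ≡⟨ cong (θ k (suc m) +_) (*-suc j m) ⟨
    θ k (suc m) + j * suc m           ≡⟨ θ-scale j k (<⇒≤ m<) ⟨
    θ (j + k) (suc m)                 ∎
  go : ∀ {h m} → h ≤′ m → m < cube k → θ (j + k) h ≤ θ (j + k) m
  go ≤′-refl          m< = ≤-refl
  go (≤′-step h≤′m) m< = ≤-trans (go h≤′m (<-trans (n<1+n _) m<)) (increment m<)

-- `δ` is the distance kept from `cube k`. For `m` beyond `cube k`, compare through
-- `M = cube k ∸ δ`: by symmetry its value is `θ k δ + suc j * M`, and the hypothesis on `θ k δ` is
-- exactly what puts this below the bound `suc j * cube k` of `θ-large`.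
θ-mono : ∀ {j k δ} → k ≤ j → 0 < δ → θ k δ ≤ suc j * δ → ∀ {h m} → h + δ ≤ cube k → h ≤ m →
  m ≤ cube (j + k) → θ (suc j + k) h ≤ θ (suc j + k) m
θ-mono {j} {k} {δ} k≤j 0<δ θδ≤ {h} {m} hδ≤ h≤m m≤ with m <? cube k
... | yes m<T = θ-mono-small (s≤s k≤j) h≤m m<T
... | no m≮T = begin
  θ (suc j + k) h            ≤⟨ θ-mono-small {suc j} {k} (s≤s k≤j) h≤M M<T ⟩
  θ (suc j + k) M            ≡⟨ θ-scale (suc j) k (m∸n≤m (cube k) δ) ⟩
  θ k M + suc j * M          ≡⟨ cong (_+ suc j * M) (θ-sym k {M} (m∸n+n≡m δ≤T)) ⟩
  θ k δ + suc j * M          ≤⟨ +-monoˡ-≤ (suc j * M) θδ≤ ⟩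
  suc j * δ + suc j * M      ≡⟨ *-distribˡ-+ (suc j) δ M ⟨
  suc j * (δ + M)            ≡⟨ cong (suc j *_) (m+[n∸m]≡n δ≤T) ⟩
  suc j * cube k             ≤⟨ θ-large k j (≮⇒≥ m≮T) m≤ ⟩
  θ (suc j + k) m            ∎
  where
  open ≤-Reasoning
  δ≤T : δ ≤ cube k
  δ≤T = m+n≤o⇒n≤o h hδ≤
  M = cube k ∸ δ
  M<T : M < cube k
  M<T = subst (M <_) (m∸n+n≡m δ≤T) (m<m+n M 0<δ)
  h≤M : h ≤ M
  h≤M = m+n≤o⇒m≤o∸n h hδ≤

θ-two : ∀ k → θ k 2 ≡ (2 + k) * 2
θ-two k = begin
  θ k 2           ≡⟨ cong (λ x → θ x 2) (+-identityʳ k) ⟨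
  θ (k + 0) 2     ≡⟨ θ-scale k 0 (m≤m+n 2 2) ⟩
  4 + k * 2       ∎
  where open ≡-Reasoning

θ-three : ∀ k → θ k 3 ≡ (1 + k) * 3
θ-three k = begin
  θ k 3           ≡⟨ cong (λ x → θ x 3) (+-identityʳ k) ⟨
  θ (k + 0) 3     ≡⟨ θ-scale k 0 (m≤m+n 3 1) ⟩
  3 + k * 3       ∎
  where open ≡-Reasoning

-- Powers of two and the parity of the dimension

cube≡2^ : ∀ k → cube k ≡ 2 ^ (2 + k)
cube≡2^ zero    = refl
cube≡2^ (suc k) = trans (cong₂ _+_ (cube≡2^ k) (cube≡2^ k)) (cong (2 ^ (2 + k) +_) (sym (+-identityʳ _)))

halve : ∀ K → (∃ λ k → K ≡ k + k) ⊎ (∃ λ k → K ≡ suc (k + k))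
halve zero = inj₁ (0 , refl)
halve (suc K) with halve K
... | inj₁ (k , refl) = inj₂ (k , refl)
... | inj₂ (k , refl) = inj₁ (suc k , cong suc (sym (+-suc k k)))

%2-even : ∀ k → (k + k) % 2 ≡ 0
%2-even k = trans (cong (_% 2) (trans (cong (k +_) (sym (+-identityʳ k))) (*-comm 2 k))) (m*n%n≡0 k 2)

%2-odd : ∀ k → suc (k + k) % 2 ≡ 1
%2-odd k = trans (cong (_% 2) (cong suc (trans (cong (k +_) (sym (+-identityʳ k))) (*-comm 2 k)))) ([m+kn]%n≡m%n 1 k 2)

⌈odd/2⌉ : ∀ k → ⌈ suc (k + k) /2⌉ ≡ suc k
⌈odd/2⌉ k = cong suc (sym (n≡⌊n+n/2⌋ k))

-- Put `n = 3 + K`; in both parities `2 ^ ⌈ n /2⌉` is `cube k` and the margin `δ` is `2 + γ`. For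
-- odd `n` there are as many outer levels as inner ones (`j = k`), and `θ k δ ≤ suc j * δ` holds
-- with equality at `δ = 3`. For even `n` there is one more (`j = suc k`), and equality occurs
-- already at `δ = 2`.
θ-mono-range : ∀ K {h m} → h + 2 + (3 + K) % 2 ≤ 2 ^ ⌈ 3 + K /2⌉ → h ≤ m → m ≤ cube K →
  θ (suc K) h ≤ θ (suc K) m
θ-mono-range K {h} {m} with halve K
... | inj₁ (k , refl) = λ hb → θ-mono {k} {k} {3} ≤-refl (s≤s z≤n) (≤-reflexive (θ-three k))
    (subst₂ _≤_ (trans (cong (h + 2 +_) odd) (+-assoc h 2 1)) half hb)
  where
  odd : (3 + (k + k)) % 2 ≡ 1
  odd = trans (cong (λ x → suc (suc x) % 2) (sym (+-suc k k))) (%2-odd (suc k))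
  half : 2 ^ ⌈ 3 + (k + k) /2⌉ ≡ cube k
  half = trans (cong (λ x → 2 ^ suc x) (⌈odd/2⌉ k)) (sym (cube≡2^ k))
... | inj₂ (k , refl) = λ hb → θ-mono {suc k} {k} {2} (n≤1+n k) (s≤s z≤n) (≤-reflexive (θ-two k))
    (subst₂ _≤_ (trans (cong (h + 2 +_) even) (+-identityʳ _)) half hb)
  where
  even : (4 + (k + k)) % 2 ≡ 0
  even = %2-even k
  half : 2 ^ ⌈ 4 + (k + k) /2⌉ ≡ cube k
  half = trans (cong (λ x → 2 ^ suc (suc x)) (sym (n≡⌈n+n/2⌉ k))) (sym (cube≡2^ k))

-- Cuts in K₄-hypercubes

sum-zero : ∀ {n} {f : Fin n → ℕ} → (∀ i → f i ≡ 0) → sum f ≡ 0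
sum-zero {n} f≡0 = trans (sum-cong-≗ f≡0) (sum-replicate-zero n)

sum-mono : ∀ {n} {f g : Fin n → ℕ} → (∀ i → f i ≤ g i) → sum f ≤ sum g
sum-mono {zero}  f≤g = z≤n
sum-mono {suc n} f≤g = +-mono-≤ (f≤g zero) (sum-mono (f≤g ∘ suc))

sum-++ : ∀ m {n} (f : Fin (m + n) → ℕ) → sum f ≡ sum (λ i → f (i ↑ˡ n)) + sum (λ j → f (m ↑ʳ j))
sum-++ zero    f = refl
sum-++ (suc m) f = trans (cong (f zero +_) (sum-++ m (f ∘ suc))) (sym (+-assoc (f zero) _ _))

∣sum-sum∣≤ : ∀ {n} (f g : Fin n → ℕ) → ∣ sum f - sum g ∣ ≤ sum (λ i → ∣ f i - g i ∣)
∣sum-sum∣≤ {zero}  f g = z≤n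
∣sum-sum∣≤ {suc n} f g = begin
  ∣ f₀ + F - g₀ + G ∣                     ≤⟨ ∣-∣-triangle (f₀ + F) (g₀ + F) (g₀ + G) ⟩
  ∣ f₀ + F - g₀ + F ∣ + ∣ g₀ + F - g₀ + G ∣
    ≡⟨ cong₂ _+_ (trans (cong₂ ∣_-_∣ (+-comm f₀ F) (+-comm g₀ F)) (∣m+n-m+o∣≡∣n-o∣ F f₀ g₀)) (∣m+n-m+o∣≡∣n-o∣ g₀ F G) ⟩
  ∣ f₀ - g₀ ∣ + ∣ F - G ∣                 ≤⟨ +-monoʳ-≤ _ (∣sum-sum∣≤ (f ∘ suc) (g ∘ suc)) ⟩
  ∣ f₀ - g₀ ∣ + sum (λ i → ∣ f (suc i) - g (suc i) ∣) ∎
  where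
  open ≤-Reasoning
  f₀ = f zero
  g₀ = g zero
  F  = sum (f ∘ suc)
  G  = sum (g ∘ suc)

-- Vertex sets as Boolean predicates

ind : Bool → ℕ
ind b = if b then 1 else 0

card : ∀ {N} → (Fin N → Bool) → ℕ
card p = sum (ind ∘ p)

cut : (G : Graph) → (Fin (V G) → Bool) → ℕ
cut G p = sum λ u → sum λ v → ind (p u ∧ not (p v) ∧ adj G u v)

Symmetric : Graph → Set
Symmetric G = ∀ u v → adj G u v ≡ adj G v u

Inside : (G : Graph) → (Fin (V G) → Bool) → Fin (V G) → Fin (V G) → Set
Inside G p a b = p a ≡ true × p b ≡ true × adj G a b ≡ true

Connected : (G : Graph) → (Fin (V G) → Bool) → Set
Connected G p = ∀ u v → p u ≡ true → p v ≡ true → Reach (Inside G p) u v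

card-≤ : ∀ {N} (p : Fin N → Bool) → card p ≤ N
card-≤ {zero}  p = z≤n
card-≤ {suc N} p with p zero
... | true  = s≤s (card-≤ (p ∘ suc))
... | false = m≤n⇒m≤1+n (card-≤ (p ∘ suc))

card-not : ∀ {N} (p : Fin N → Bool) → card p + card (not ∘ p) ≡ N
card-not {zero}  p = refl
card-not {suc N} p with p zero
... | true  = cong suc (card-not (p ∘ suc))
... | false = trans (+-suc _ _) (cong suc (card-not (p ∘ suc)))

cut-cong : ∀ G {p q : Fin (V G) → Bool} → (∀ x → p x ≡ q x) → cut G p ≡ cut G q
cut-cong G p≗q = sum-cong-≗ λ u → sum-cong-≗ λ v →
  cong₂ (λ x y → ind (x ∧ not y ∧ adj G u v)) (p≗q u) (p≗q v)

cut-empty : ∀ G → cut G (const false) ≡ 0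
cut-empty G = sum-zero {V G} λ _ → sum-replicate-zero (V G)

-- Exchanging the two summations reverses each crossing pair.
cut-not : ∀ G → Symmetric G → ∀ p → cut G (not ∘ p) ≡ cut G p
cut-not G symG p = trans
  (∑-comm λ u v → ind (not (p u) ∧ not (not (p v)) ∧ adj G u v))
  (sum-cong-≗ λ v → sum-cong-≗ λ u → cong ind (swap (p u) (p v) (symG u v)))
  where
  swap : ∀ x y {a b} → a ≡ b → not x ∧ not (not y) ∧ a ≡ y ∧ not x ∧ b
  swap true  true  refl = refl
  swap true  false refl = refl
  swap false true  refl = refl
  swap false false refl = refl

reach-map : ∀ {M N} {A : Fin M → Fin M → Set} {B : Fin N → Fin N → Set} (f : Fin M → Fin N) →
  (∀ {a b} → A a b → B (f a) (f b)) → ∀ {u v} → Reach A u v → Reach B (f u) (f v)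
reach-map f A⇒B here         = here
reach-map f A⇒B (there e es) = there (A⇒B e) (reach-map f A⇒B es)

reach-trans : ∀ {N} {A : Fin N → Fin N → Set} {u v w} → Reach A u v → Reach A v w → Reach A u w
reach-trans here         es′ = es′
reach-trans (there e es) es′ = there e (reach-trans es es′)

connected-cong : ∀ (G : Graph) {p q : Fin (V G) → Bool} → (∀ x → p x ≡ q x) → Connected G p → Connected G q
connected-cong G p≗q conn u v qu qv = reach-map (λ x → x)
  (λ (pa , pb , e) → trans (sym (p≗q _)) pa , trans (sym (p≗q _)) pb , e)
  (conn u v (trans (p≗q u) qu) (trans (p≗q v) qv))

-- In a perfect matching a vertex has one partner `c`, so a sum over its possible partners collapses
-- to one term.
sum-delta : ∀ {n} (c : Fin n) (f : Fin n → Bool) → sum (λ b → ind (f b ∧ ⌊ c ≟ b ⌋)) ≡ ind (f c)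
sum-delta zero f = trans (cong₂ _+_ (cong ind (∧-identityʳ (f zero))) (sum-zero λ b → cong ind (∧-zeroʳ (f (suc b))))) (+-identityʳ _)
sum-delta (suc c) f = trans (cong₂ _+_ (cong ind (∧-zeroʳ (f zero)))
    (sum-cong-≗ λ b → cong (λ x → ind (f (suc b) ∧ x)) (≟-suc b)))
  (sum-delta c (f ∘ suc))
  where
  ≟-suc : ∀ b → ⌊ suc c ≟ suc b ⌋ ≡ ⌊ c ≟ b ⌋
  ≟-suc b = trans (isYes≗does (suc c ≟ suc b)) (sym (isYes≗does (c ≟ b)))

∧-shuffle : ∀ x y z → x ∧ not y ∧ z ≡ (x ∧ not y) ∧ z
∧-shuffle x y z = sym (∧-assoc x (not y) z)

-- The invariant carried through the recursive construction. `lower` ranges over arbitrary vertex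
-- sets, because the traces of a set on the two halves may be disconnected; `attained` provides the
-- connectedness that `IsXi` asks for.
record Extremal (k : ℕ) (G : Graph) : Set where
  field
    order     : V G ≡ cube k
    symmetric : Symmetric G
    connected : Connected G (const true)
    lower     : ∀ p → θ k (card p) ≤ cut G p
    attained  : ∀ m → m ≤ cube k → ∃ λ p → card p ≡ m × cut G p ≡ θ k m ×
                  Connected G p × Connected G (not ∘ p)
open Extremal

-- Transport along isomorphisms

module _ {G H : Graph} (iso : G ≅ H) where
  private
    π : Permutation (V G) (V H)
    π = ⤖⇒↔ (proj₁ iso)

    adj-from : ∀ x y → adj H x y ≡ adj G (π ⟨$⟩ˡ x) (π ⟨$⟩ˡ y)
    adj-from x y = trans (sym (cong₂ (adj H) (inverseʳ π) (inverseʳ π))) (sym (proj₂ iso _ _))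

  card-iso : ∀ q → card (q ∘ (π ⟨$⟩ʳ_)) ≡ card q
  card-iso q = sym (sum-permute (ind ∘ q) π)

  cut-iso : ∀ q → cut G (q ∘ (π ⟨$⟩ʳ_)) ≡ cut H q
  cut-iso q = sym (trans (sum-permute _ π) (sum-cong-≗ λ u → trans (sum-permute _ π) (sum-cong-≗ λ v →
    cong (λ x → ind (q (π ⟨$⟩ʳ u) ∧ not (q (π ⟨$⟩ʳ v)) ∧ x)) (sym (proj₂ iso u v)))))

  connected-iso : ∀ q → Connected H q → Connected G (q ∘ (π ⟨$⟩ʳ_))
  connected-iso q conn u v qu qv = subst₂ (Reach _) (inverseˡ π) (inverseˡ π)
    (reach-map (π ⟨$⟩ˡ_) inside (conn (π ⟨$⟩ʳ u) (π ⟨$⟩ʳ v) qu qv))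
    where
    inside : ∀ {a b} → Inside H q a b → Inside G (q ∘ (π ⟨$⟩ʳ_)) (π ⟨$⟩ˡ a) (π ⟨$⟩ˡ b)
    inside {a} {b} (qa , qb , ab) = trans (cong q (inverseʳ π)) qa , trans (cong q (inverseʳ π)) qb ,
      trans (sym (adj-from a b)) ab

  extremal-iso : ∀ {k} → Extremal k H → Extremal k G
  extremal-iso E .order = trans (↔⇒≡ π) (E .order)
  extremal-iso E .symmetric u v = trans (proj₂ iso u v) (trans (E .symmetric _ _) (sym (proj₂ iso v u)))
  extremal-iso E .connected = connected-iso (const true) (E .connected)
  extremal-iso {k} E .lower p = subst₂ (λ x y → θ k x ≤ y)
      (trans (sym (card-iso q)) (sum-cong-≗ λ x → cong ind (q∘π x)))
      (trans (sym (cut-iso q)) (cut-cong G q∘π))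
      (E .lower q)
    where
    q : Fin (V H) → Bool
    q = p ∘ (π ⟨$⟩ˡ_)
    q∘π : ∀ x → q (π ⟨$⟩ʳ x) ≡ p x
    q∘π x = cong p (inverseˡ π)
  extremal-iso E .attained m m≤ with E .attained m m≤
  ... | q , card≡ , cut≡ , conn , conn′ = q ∘ (π ⟨$⟩ʳ_) , trans (card-iso q) card≡ ,
    trans (cut-iso q) cut≡ , connected-iso q conn , connected-iso (not ∘ q) conn′

K4-connected : ∀ p → Connected K4 p
K4-connected p u v pu pv with u ≟ v in eq
... | yes refl = here
... | no  _    = there (pu , pv , cong (not ∘ ⌊_⌋) eq) here

-- In `K4` every set of `m` vertices has exactly `m * (4 ∸ m)` boundary edges, and every set induces
-- a connected graph.
extremal-K4 : Extremal 0 K4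
extremal-K4 .order = refl
extremal-K4 .symmetric = toWitness {a? = all? λ u → all? λ v → adj K4 u v Bool.≟ adj K4 v u} _
extremal-K4 .connected = K4-connected _
-- `card p` and `cut K4 p` compute from the four values of `p`, which leaves sixteen closed cases.
extremal-K4 .lower p = bound (p zero) (p (suc zero)) (p (suc (suc zero))) (p (suc (suc (suc zero))))
  where
  κ : Bool → Bool → Bool → Bool → Fin 4 → Bool
  κ a b c d zero                   = a
  κ a b c d (suc zero)             = b
  κ a b c d (suc (suc zero))       = c
  κ a b c d (suc (suc (suc zero))) = d
  bound : ∀ a b c d → θ 0 (card (κ a b c d)) ≤ cut K4 (κ a b c d)
  bound true  true  true  true  = ≤-refl
  bound true  true  true  false = ≤-refl
  bound true  true  false true  = ≤-refl
  bound true  true  false false = ≤-refl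
  bound true  false true  true  = ≤-refl
  bound true  false true  false = ≤-refl
  bound true  false false true  = ≤-refl
  bound true  false false false = ≤-refl
  bound false true  true  true  = ≤-refl
  bound false true  true  false = ≤-refl
  bound false true  false true  = ≤-refl
  bound false true  false false = ≤-refl
  bound false false true  true  = ≤-refl
  bound false false true  false = ≤-refl
  bound false false false true  = ≤-refl
  bound false false false false = ≤-refl
extremal-K4 .attained m m≤ = initial m , initial-spec m m≤ .proj₁ , initial-spec m m≤ .proj₂ , K4-connected _ , K4-connected _
  where
  initial : ℕ → Fin 4 → Bool
  initial m u = toℕ u <ᵇ m
  initial-spec : ∀ m → m ≤ 4 → card (initial m) ≡ m × cut K4 (initial m) ≡ θ 0 m
  initial-spec 0 _ = refl , refl
  initial-spec 1 _ = refl , refl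
  initial-spec 2 _ = refl , refl
  initial-spec 3 _ = refl , refl
  initial-spec 4 _ = refl , refl
  initial-spec (suc (suc (suc (suc (suc _))))) (s≤s (s≤s (s≤s (s≤s ()))))

-- Graphs joined by a perfect matching

module _ (G₀ G₁ : Graph) (π : Fin (V G₀) ⤖ Fin (V G₁)) where
  private
    J = matchJoin G₀ G₁ π
    ρ : Permutation (V G₀) (V G₁)
    ρ = ⤖⇒↔ π
    inl : Fin (V G₀) → Fin (V J)
    inl a = a ↑ˡ V G₁
    inr : Fin (V G₁) → Fin (V J)
    inr b = V G₀ ↑ʳ b

    adj-ll : ∀ a b → adj J (inl a) (inl b) ≡ adj G₀ a b
    adj-ll a b rewrite splitAt-↑ˡ (V G₀) a (V G₁) | splitAt-↑ˡ (V G₀) b (V G₁) = refl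
    adj-rr : ∀ a b → adj J (inr a) (inr b) ≡ adj G₁ a b
    adj-rr a b rewrite splitAt-↑ʳ (V G₀) (V G₁) a | splitAt-↑ʳ (V G₀) (V G₁) b = refl
    adj-lr : ∀ a b → adj J (inl a) (inr b) ≡ ⌊ ρ ⟨$⟩ʳ a ≟ b ⌋
    adj-lr a b rewrite splitAt-↑ˡ (V G₀) a (V G₁) | splitAt-↑ʳ (V G₀) (V G₁) b = refl
    adj-rl : ∀ a b → adj J (inr b) (inl a) ≡ ⌊ ρ ⟨$⟩ʳ a ≟ b ⌋
    adj-rl a b rewrite splitAt-↑ˡ (V G₀) a (V G₁) | splitAt-↑ʳ (V G₀) (V G₁) b = refl

    data Side : Fin (V J) → Set where
      left  : ∀ a → Side (inl a)
      right : ∀ b → Side (inr b)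

    side : ∀ x → Side x
    side x with splitAt (V G₀) x in eq
    ... | inj₁ a = subst Side (trans (cong (join (V G₀) (V G₁)) (sym eq)) (join-splitAt (V G₀) (V G₁) x)) (left a)
    ... | inj₂ b = subst Side (trans (cong (join (V G₀) (V G₁)) (sym eq)) (join-splitAt (V G₀) (V G₁) x)) (right b)

  join-symmetric : Symmetric G₀ → Symmetric G₁ → Symmetric J
  join-symmetric sym₀ sym₁ u v with side u | side v
  ... | left a  | left b  = trans (adj-ll a b) (trans (sym₀ a b) (sym (adj-ll b a)))
  ... | left a  | right b = trans (adj-lr a b) (sym (adj-rl a b))
  ... | right b | left a  = trans (adj-rl a b) (sym (adj-lr a b))
  ... | right a | right b = trans (adj-rr a b) (trans (sym₁ a b) (sym (adj-rr b a)))

  card-join : ∀ p → card p ≡ card (p ∘ inl) + card (p ∘ inr)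
  card-join p = sum-++ (V G₀) (ind ∘ p)

  -- Split the double sum into the four blocks of the adjacency matrix. The mixed blocks collapse
  -- along the matching, where a matched pair counts 1 exactly when `p` separates it, in either
  -- direction.
  cut-join : ∀ p → cut J p ≡ cut G₀ (p ∘ inl) + cut G₁ (p ∘ inr) +
                              sum (λ a → ∣ ind (p (inl a)) - ind (p (inr (ρ ⟨$⟩ʳ a))) ∣)
  cut-join p = begin
    cut J p
      ≡⟨ sum-++ (V G₀) _ ⟩
    sum (λ a → sum (E (inl a))) + sum (λ b → sum (E (inr b)))
      ≡⟨ cong₂ _+_ (trans (sum-cong-≗ λ a → sum-++ (V G₀) (E (inl a))) (∑-distrib-+ (λ a → sum λ a′ → E (inl a) (inl a′)) _))
                   (trans (sum-cong-≗ λ b → sum-++ (V G₀) (E (inr b))) (∑-distrib-+ (λ b → sum λ a → E (inr b) (inl a)) _)) ⟩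
    (sum λ a → sum λ a′ → E (inl a) (inl a′)) + (sum λ a → sum λ b → E (inl a) (inr b)) +
      ((sum λ b → sum λ a → E (inr b) (inl a)) + (sum λ b → sum λ b′ → E (inr b) (inr b′)))
      ≡⟨ cong₂ _+_ (cong₂ _+_ ll lr) (cong₂ _+_ rl rr) ⟩
    cut G₀ (p ∘ inl) + sum out + (sum back + cut G₁ (p ∘ inr))
      ≡⟨ regroup (cut G₀ (p ∘ inl)) (sum out) (sum back) (cut G₁ (p ∘ inr)) ⟩
    cut G₀ (p ∘ inl) + cut G₁ (p ∘ inr) + (sum out + sum back)
      ≡⟨ cong (cut G₀ (p ∘ inl) + cut G₁ (p ∘ inr) +_)
              (trans (sym (∑-distrib-+ out back)) (sum-cong-≗ λ a → ind-dist (p (inl a)) (p (inr (ρ ⟨$⟩ʳ a))))) ⟩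
    cut G₀ (p ∘ inl) + cut G₁ (p ∘ inr) + sum (λ a → ∣ ind (p (inl a)) - ind (p (inr (ρ ⟨$⟩ʳ a))) ∣) ∎
    where
    open ≡-Reasoning
    E : Fin (V J) → Fin (V J) → ℕ
    E u v = ind (p u ∧ not (p v) ∧ adj J u v)
    out back : Fin (V G₀) → ℕ
    out a  = ind (p (inl a) ∧ not (p (inr (ρ ⟨$⟩ʳ a))))
    back a = ind (p (inr (ρ ⟨$⟩ʳ a)) ∧ not (p (inl a)))
    ll : (sum λ a → sum λ a′ → E (inl a) (inl a′)) ≡ cut G₀ (p ∘ inl)
    ll = sum-cong-≗ λ a → sum-cong-≗ λ a′ → cong (λ x → ind (p (inl a) ∧ not (p (inl a′)) ∧ x)) (adj-ll a a′)
    rr : (sum λ b → sum λ b′ → E (inr b) (inr b′)) ≡ cut G₁ (p ∘ inr)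
    rr = sum-cong-≗ λ b → sum-cong-≗ λ b′ → cong (λ x → ind (p (inr b) ∧ not (p (inr b′)) ∧ x)) (adj-rr b b′)
    lr : (sum λ a → sum λ b → E (inl a) (inr b)) ≡ sum out
    lr = sum-cong-≗ λ a → trans
      (sum-cong-≗ λ b → cong ind (trans (cong (λ x → p (inl a) ∧ not (p (inr b)) ∧ x) (adj-lr a b)) (∧-shuffle (p (inl a)) _ _)))
      (sum-delta (ρ ⟨$⟩ʳ a) (λ b → p (inl a) ∧ not (p (inr b))))
    rl : (sum λ b → sum λ a → E (inr b) (inl a)) ≡ sum back
    rl = trans (∑-comm (λ b a → E (inr b) (inl a))) (sum-cong-≗ λ a → trans
      (sum-cong-≗ λ b → cong ind (trans (cong (λ x → p (inr b) ∧ not (p (inl a)) ∧ x) (adj-rl a b)) (∧-shuffle (p (inr b)) _ _)))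
      (sum-delta (ρ ⟨$⟩ʳ a) (λ b → p (inr b) ∧ not (p (inl a)))))
    regroup : ∀ x y z w → x + y + (z + w) ≡ x + w + (y + z)
    regroup = solve-∀
    ind-dist : ∀ x y → ind (x ∧ not y) + ind (y ∧ not x) ≡ ∣ ind x - ind y ∣
    ind-dist true  true  = refl
    ind-dist true  false = refl
    ind-dist false true  = refl
    ind-dist false false = refl

  -- The triangle inequality over the matched pairs, after reindexing the right half by the
  -- matching.
  cut-join-≥ : ∀ p → cut G₀ (p ∘ inl) + cut G₁ (p ∘ inr) + ∣ card (p ∘ inl) - card (p ∘ inr) ∣ ≤ cut J p
  cut-join-≥ p = begin
    C + ∣ card (p ∘ inl) - card (p ∘ inr) ∣
      ≡⟨ cong (λ x → C + ∣ card (p ∘ inl) - x ∣) (sum-permute (ind ∘ p ∘ inr) ρ) ⟩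
    C + ∣ card (p ∘ inl) - card (p ∘ inr ∘ (ρ ⟨$⟩ʳ_)) ∣
      ≤⟨ +-monoʳ-≤ C (∣sum-sum∣≤ (ind ∘ p ∘ inl) _) ⟩
    C + sum (λ a → ∣ ind (p (inl a)) - ind (p (inr (ρ ⟨$⟩ʳ a))) ∣)
      ≡⟨ cut-join p ⟨
    cut J p ∎
    where
    open ≤-Reasoning
    C = cut G₀ (p ∘ inl) + cut G₁ (p ∘ inr)

  private
    matched : ∀ a → adj J (inl a) (inr (ρ ⟨$⟩ʳ a)) ≡ true × adj J (inr (ρ ⟨$⟩ʳ a)) (inl a) ≡ true
    matched a = trans (adj-lr a _) same , trans (adj-rl a _) same
      where
      same : ⌊ ρ ⟨$⟩ʳ a ≟ ρ ⟨$⟩ʳ a ⌋ ≡ true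
      same with ρ ⟨$⟩ʳ a ≟ ρ ⟨$⟩ʳ a
      ... | yes _  = refl
      ... | no neq = contradiction refl neq

  -- Every left vertex of the set steps to its partner in the set, and paths between partners run
  -- inside the right half.
  connected-join : ∀ p → Connected G₁ (p ∘ inr) →
    (∀ a → p (inl a) ≡ true → p (inr (ρ ⟨$⟩ʳ a)) ≡ true) → Connected J p
  connected-join p conn₁ covered u v pu pv with toRight (side u) pu | toRight (side v) pv
    where
    toRight : ∀ {x} → Side x → p x ≡ true →
      ∃ λ b → p (inr b) ≡ true × Reach (Inside J p) x (inr b) × Reach (Inside J p) (inr b) x
    toRight (left a) pa = ρ ⟨$⟩ʳ a , covered a pa ,
      there (pa , covered a pa , proj₁ (matched a)) here , there (covered a pa , pa , proj₂ (matched a)) here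
    toRight (right b) pb = b , pb , here , here
  ... | b , pb , u⇝b , _ | c , pc , _ , c⇝v = reach-trans u⇝b (reach-trans b⇝c c⇝v)
    where
    b⇝c : Reach (Inside J p) (inr b) (inr c)
    b⇝c = reach-map inr (λ (px , py , e) → px , py , trans (adj-rr _ _) e) (conn₁ b c pb pc)

  connected-left : ∀ p → Connected G₀ (p ∘ inl) → (∀ b → p (inr b) ≡ false) → Connected J p
  connected-left p conn₀ empty u v pu pv with side u | side v
  ... | right b | _       = contradiction (trans (sym pu) (empty b)) λ ()
  ... | left _  | right b = contradiction (trans (sym pv) (empty b)) λ ()
  ... | left a  | left a′ = reach-map inl (λ (px , py , e) → px , py , trans (adj-ll _ _) e) (conn₀ a a′ pu pv)

  extendˡ : (Fin (V G₀) → Bool) → Fin (V J) → Bool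
  extendˡ p = [ p , const false ]′ ∘ splitAt (V G₀)

  private
    extendˡ-inl : ∀ p a → extendˡ p (inl a) ≡ p a
    extendˡ-inl p a = cong [ p , const false ]′ (splitAt-↑ˡ (V G₀) a (V G₁))
    extendˡ-inr : ∀ p b → extendˡ p (inr b) ≡ false
    extendˡ-inr p b = cong [ p , const false ]′ (splitAt-↑ʳ (V G₀) (V G₁) b)

  card-extendˡ : ∀ p → card (extendˡ p) ≡ card p
  card-extendˡ p = trans (card-join (extendˡ p)) (trans (cong₂ _+_
    (sum-cong-≗ λ a → cong ind (extendˡ-inl p a)) (sum-zero λ b → cong ind (extendˡ-inr p b))) (+-identityʳ _))

  cut-extendˡ : ∀ p → cut J (extendˡ p) ≡ cut G₀ p + card p
  cut-extendˡ p = trans (cut-join (extendˡ p)) (cong₂ _+_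
    (trans (cong₂ _+_ (cut-cong G₀ (extendˡ-inl p)) (trans (cut-cong G₁ (extendˡ-inr p)) (cut-empty G₁))) (+-identityʳ _))
    (sum-cong-≗ λ a → trans (cong₂ (λ x y → ∣ ind x - ind y ∣) (extendˡ-inl p a) (extendˡ-inr p _)) (∣-∣-identityʳ _)))

  -- An optimal set of `G₀` is kept in the left half, where its `m` matching edges add `m` to the
  -- cut. Its complement contains the whole right half and is connected through it.
  join-attained : ∀ {k} → Extremal k G₀ → Connected G₁ (const true) → ∀ {m} → m ≤ cube k →
    ∃ λ p → card p ≡ m × cut J p ≡ θ (suc k) m × Connected J p × Connected J (not ∘ p)
  join-attained {k} E₀ conn₁ {m} m≤ with E₀ .attained m m≤
  ... | q , card≡ , cut≡ , conn , conn′ = extendˡ q , trans (card-extendˡ q) card≡ ,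
    trans (cut-extendˡ q) (trans (cong₂ _+_ cut≡ card≡) (sym (θ-low k m≤))) ,
    connected-left (extendˡ q) (connected-cong G₀ (sym ∘ extendˡ-inl q) conn) (extendˡ-inr q) ,
    connected-join (not ∘ extendˡ q)
      (connected-cong G₁ (λ b → cong not (sym (extendˡ-inr q b))) conn₁)
      (λ a _ → cong not (extendˡ-inr q _))

  extremal-join : ∀ {k} → Extremal k G₀ → Extremal k G₁ → Extremal (suc k) J
  extremal-join E₀ E₁ .order = cong₂ _+_ (E₀ .order) (E₁ .order)
  extremal-join E₀ E₁ .symmetric = join-symmetric (E₀ .symmetric) (E₁ .symmetric)
  extremal-join E₀ E₁ .connected = connected-join (const true) (E₁ .connected) (λ _ _ → refl)
  extremal-join {k} E₀ E₁ .lower p = begin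
    θ (suc k) (card p)        ≡⟨ cong (θ (suc k)) (card-join p) ⟩
    θ (suc k) (a + b)         ≤⟨ θ-join k (≤-trans (card-≤ (p ∘ inl)) (≤-reflexive (E₀ .order)))
                                          (≤-trans (card-≤ (p ∘ inr)) (≤-reflexive (E₁ .order))) ⟩
    θ k a + θ k b + ∣ a - b ∣ ≤⟨ +-monoˡ-≤ ∣ a - b ∣ (+-mono-≤ (E₀ .lower (p ∘ inl)) (E₁ .lower (p ∘ inr))) ⟩
    cut G₀ (p ∘ inl) + cut G₁ (p ∘ inr) + ∣ a - b ∣ ≤⟨ cut-join-≥ p ⟩
    cut J p                   ∎
    where
    open ≤-Reasoning
    a = card (p ∘ inl)
    b = card (p ∘ inr)
  extremal-join {k} E₀ E₁ .attained m m≤ with ≤-total m (cube k)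
  ... | inj₁ m≤T = join-attained E₀ (E₁ .connected) m≤T
  -- A size of at least half is realised by the complement of an optimal set of size
  -- `cube (suc k) ∸ m`.
  ... | inj₂ T≤m with join-attained E₀ (E₁ .connected) (m≤n+o⇒m∸n≤o (cube (suc k)) m (+-monoˡ-≤ (cube k) T≤m))
  ...   | p , card≡ , cut≡ , conn , conn′ = not ∘ p ,
    +-cancelˡ-≡ (card p) _ _ (trans (card-not p) (trans (cong₂ _+_ (E₀ .order) (E₁ .order))
      (sym (trans (cong (_+ m) card≡) (m∸n+n≡m m≤))))) ,
    trans (cut-not J (join-symmetric (E₀ .symmetric) (E₁ .symmetric)) p)
      (trans cut≡ (θ-sym (suc k) {cube (suc k) ∸ m} (m∸n+n≡m m≤))) ,
    conn′ , connected-cong J (λ x → sym (not-involutive (p x))) conn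

extremal : ∀ k {G} → K4Hypercube (2 + k) G → Extremal k G
extremal zero    (base iso)             = extremal-iso iso extremal-K4
-- A join of dimension 2 would need halves of dimension 1, and there are none.
extremal zero    (step _ _ () _ _ _)
extremal (suc k) (step G₀ G₁ h₀ h₁ π iso) =
  extremal-iso iso (extremal-join G₀ G₁ π (extremal k h₀) (extremal k h₁))

-- Extra cuts

sum-allFin : ∀ {n} (f : Fin n → ℕ) → sumᴸ (map f (allFin n)) ≡ sum f
sum-allFin {n} f = trans (cong sumᴸ (map-tabulate id f)) (go f)
  where
  go : ∀ {n} (f : Fin n → ℕ) → sumᴸ (Data.List.tabulate f) ≡ sum f
  go {zero}  f = refl
  go {suc n} f = cong (f zero +_) (go (f ∘ suc))

∑∑-allFin : ∀ {n} (f : Fin n → Fin n → ℕ) →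
  sumᴸ (map (λ u → sumᴸ (map (f u) (allFin n))) (allFin n)) ≡ sum λ u → sum (f u)
∑∑-allFin {n} f = trans (sum-allFin {n} _) (sum-cong-≗ λ u → sum-allFin (f u))

cutSize≡cut : ∀ G X → cutSize G X ≡ cut G (lookup X)
cutSize≡cut G X = ∑∑-allFin {V G} _

∣∣≡card : ∀ {n} (X : Subset n) → ∣ X ∣ ≡ card (lookup X)
∣∣≡card []          = refl
∣∣≡card (true  ∷ X) = cong suc (∣∣≡card X)
∣∣≡card (false ∷ X) = ∣∣≡card X

Connected⇒Induced : ∀ G X {p} → (∀ x → lookup X x ≡ p x) → Connected G p → InducedConnected G X
Connected⇒Induced G X {p} X≗p conn u v u∈ v∈ =
  reach-map id (λ (pa , pb , e) → member pa , member pb , e) (conn u v (member⁻¹ u∈) (member⁻¹ v∈))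
  where
  member : ∀ {x} → p x ≡ true → x ∈ X
  member {x} px = lookup⇒[]= x X (trans (X≗p x) px)
  member⁻¹ : ∀ {x} → x ∈ X → p x ≡ true
  member⁻¹ {x} x∈ = trans (sym (X≗p x)) ([]=⇒lookup x∈)

-- An enumeration of the set with its inverse, used to pass between the injections from `Fin h` in
-- `IsExtraCut` and bounds on `card`.
record Members {N} (p : Fin N → Bool) (c : ℕ) : Set where
  field
    member     : Fin c → Fin N
    injective  : Injective _≡_ _≡_ member
    sound      : ∀ i → p (member i) ≡ true
    index      : ∀ {x} → p x ≡ true → Fin c
    member-index : ∀ {x} (px : p x ≡ true) → member (index px) ≡ x

members : ∀ {N} (p : Fin N → Bool) → Members p (card p)
members {zero}  p = record
  { member = λ () ; injective = λ {} ; sound = λ () ; index = λ {} ; member-index = λ {} }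
members {suc N} p with p zero in eq | members (p ∘ suc)
... | true  | M = record
  { member       = λ { zero → zero ; (suc i) → suc (member i) }
  ; injective    = λ { {zero} {zero} _ → refl ; {suc i} {suc j} e → cong suc (injective (suc-injective e)) }
  ; sound        = λ { zero → eq ; (suc i) → sound i }
  ; index        = λ { {zero} _ → zero ; {suc x} px → suc (index px) }
  ; member-index = λ { {zero} _ → refl ; {suc x} px → cong suc (member-index px) }
  }
  where open Members M
... | false | M = record
  { member       = suc ∘ member
  ; injective    = injective ∘ suc-injective
  ; sound        = sound
  ; index        = λ { {zero} pz → contradiction (trans (sym eq) pz) λ () ; {suc x} px → index px }
  ; member-index = λ { {zero} pz → contradiction (trans (sym eq) pz) λ () ; {suc x} px → cong suc (member-index px) }
  }
  where open Members M

injection⇒≤card : ∀ {h N} (p : Fin N → Bool) (g : Fin h → Fin N) → Injective _≡_ _≡_ g →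
  (∀ i → p (g i) ≡ true) → h ≤ card p
injection⇒≤card p g g-injective pg = injective⇒≤ {f = λ i → index (pg i)} λ {i} {j} e →
  g-injective (trans (sym (member-index (pg i))) (trans (cong member e) (member-index (pg j))))
  where open Members (members p)

≤card⇒injection : ∀ {h N} (p : Fin N → Bool) → h ≤ card p →
  Σ (Fin h → Fin N) λ g → Injective _≡_ _≡_ g × (∀ i → p (g i) ≡ true)
≤card⇒injection p h≤ = (λ i → member (inject≤ i h≤)) ,
  (λ e → inject≤-injective h≤ h≤ _ _ (injective e)) , λ i → sound (inject≤ i h≤)
  where open Members (members p)

-- Boundaries as edge sets

boundary : (G : Graph) → Symmetric G → (Fin (V G) → Bool) → EdgeSet G
boundary G symG p .mem u v = adj G u v ∧ (p u xor p v)
boundary G symG p .EdgeSet.sym u v = cong₂ _∧_ (symG u v) (xor-comm (p u) (p v))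
boundary G symG p .sub u v e with adj G u v
... | true = refl

lt : ∀ {N} → Fin N → Fin N → Bool
lt u v = ⌊ toℕ u <? toℕ v ⌋

-- Each crossing pair (u , v) is counted by cut as oriented from p to its complement, and by
-- edgeSetSize as oriented upwards: transpose the part of the double sum below the diagonal.
boundary-size : ∀ G (symG : Symmetric G) p → edgeSetSize (boundary G symG p) ≡ cut G p
boundary-size G symG p = begin
  edgeSetSize (boundary G symG p)
    ≡⟨ ∑∑-allFin {V G} _ ⟩
  (sum λ u → sum λ v → ind (lt u v ∧ adj G u v ∧ (p u xor p v)))
    ≡⟨ (sum-cong-≗ λ u → sum-cong-≗ λ v → unorient (lt u v) (symG u v) (p u) (p v)) ⟨
  (sum λ u → sum λ v → up u v + down v u)
    ≡⟨ distrib up (λ u v → down v u) ⟩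
  (sum λ u → sum λ v → up u v) + (sum λ u → sum λ v → down v u)
    ≡⟨ cong ((sum λ u → sum λ v → up u v) +_) (∑-comm λ u v → down v u) ⟩
  (sum λ u → sum λ v → up u v) + (sum λ u → sum λ v → down u v)
    ≡⟨ distrib up down ⟨
  (sum λ u → sum λ v → up u v + down u v)
    ≡⟨ (sum-cong-≗ λ u → sum-cong-≗ λ v → by-order u v) ⟩
  cut G p ∎
  where
  open ≡-Reasoning
  cross : Fin (V G) → Fin (V G) → Bool
  cross u v = p u ∧ not (p v) ∧ adj G u v
  up down : Fin (V G) → Fin (V G) → ℕ
  up u v   = ind (lt u v ∧ cross u v)
  down u v = ind (lt v u ∧ cross u v)
  distrib : (f g : Fin (V G) → Fin (V G) → ℕ) → (sum λ u → sum λ v → f u v + g u v) ≡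
    (sum λ u → sum λ v → f u v) + (sum λ u → sum λ v → g u v)
  distrib f g = trans (sum-cong-≗ λ u → ∑-distrib-+ (f u) (g u)) (∑-distrib-+ (λ u → sum (f u)) (λ u → sum (g u)))
  unorient : ∀ l {a b} → a ≡ b → ∀ x y →
    ind (l ∧ x ∧ not y ∧ a) + ind (l ∧ y ∧ not x ∧ b) ≡ ind (l ∧ a ∧ (x xor y))
  unorient false refl x y = refl
  unorient true {true} refl true  true  = refl
  unorient true {true} refl true  false = refl
  unorient true {true} refl false true  = refl
  unorient true {true} refl false false = refl
  unorient true {false} refl true  true  = refl
  unorient true {false} refl true  false = refl
  unorient true {false} refl false true  = refl
  unorient true {false} refl false false = refl
  by-order : ∀ u v → up u v + down u v ≡ ind (cross u v)
  by-order u v with toℕ u <? toℕ v | toℕ v <? toℕ u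
  ... | yes u<v | yes v<u = contradiction v<u (<-asym u<v)
  ... | yes _   | no  _   = +-identityʳ _
  ... | no  _   | yes _   = refl
  ... | no u≮v  | no v≮u  = sym (cong ind (diagonal (toℕ-injective (≤-antisym (≮⇒≥ v≮u) (≮⇒≥ u≮v)))))
    where
    diagonal : u ≡ v → cross u v ≡ false
    diagonal refl = trans (sym (∧-assoc (p u) _ _)) (cong (_∧ adj G u u) (∧-inverseʳ (p u)))

edgeSetSize-mono : ∀ {G} {E F : EdgeSet G} → (∀ u v → mem E u v ≡ true → mem F u v ≡ true) →
  edgeSetSize E ≤ edgeSetSize F
edgeSetSize-mono {G} {E} {F} E⊆F = subst₂ _≤_ (sym (∑∑-allFin {V G} _)) (sym (∑∑-allFin {V G} _))
  (sum-mono λ u → sum-mono λ v → pointwise (lt u v) (E⊆F u v))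
  where
  pointwise : ∀ l {a b} → (a ≡ true → b ≡ true) → ind (l ∧ a) ≤ ind (l ∧ b)
  pointwise false         a⇒b = z≤n
  pointwise true {false}  a⇒b = z≤n
  pointwise true {true}   a⇒b rewrite a⇒b refl = ≤-refl

remAdj-sym : ∀ {G} → Symmetric G → (F : EdgeSet G) → ∀ {u v} → RemAdj G F u v → RemAdj G F v u
remAdj-sym symG F {u} {v} e = trans (cong₂ (λ a m → a ∧ not m) (symG v u) (EdgeSet.sym F v u)) e

reach-sym : ∀ {N} {A : Fin N → Fin N → Set} → (∀ {a b} → A a b → A b a) → ∀ {u v} → Reach A u v → Reach A v u
reach-sym symA here         = here
reach-sym symA (there e es) = reach-trans (reach-sym symA es) (there (symA e) here)

reach-closed : ∀ {N} {A : Fin N → Fin N → Set} (p : Fin N → Bool) → (∀ {a b} → A a b → p a ≡ p b) →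
  ∀ {u v} → Reach A u v → p u ≡ p v
reach-closed p closed here         = refl
reach-closed p closed (there e es) = trans (closed e) (reach-closed p closed es)

-- The surviving edges never change sides, so the two sides are separated; each side is connected by
-- surviving edges, so each vertex reaches its whole side.
boundary-isExtraCut : ∀ {G} (symG : Symmetric G) {h} → 1 ≤ h → ∀ p → h ≤ card p → h ≤ card (not ∘ p) →
  Connected G p → Connected G (not ∘ p) → IsExtraCut h G (boundary G symG p)
boundary-isExtraCut {G} symG {h} 1≤h p h≤ h≤′ conn conn′ = separated , large
  where
  F = boundary G symG p
  same-side : ∀ a {x y} → a ∧ not (a ∧ (x xor y)) ≡ true → x ≡ y
  same-side true {true}  {true}  _ = refl
  same-side true {false} {false} _ = refl
  kept : ∀ {a x y} → x ≡ y → a ≡ true → a ∧ not (a ∧ (x xor y)) ≡ true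
  kept {x = true}  refl refl = refl
  kept {x = false} refl refl = refl
  inside : ∀ {q} → (∀ {a b} → q a ≡ true → q b ≡ true → p a ≡ p b) → ∀ {a b} → Inside G q a b → RemAdj G F a b
  inside agree (qa , qb , e) = kept (agree qa qb) e
  agree : ∀ {a b} → p a ≡ true → p b ≡ true → p a ≡ p b
  agree pa pb = trans pa (sym pb)
  agree′ : ∀ {a b} → not (p a) ≡ true → not (p b) ≡ true → p a ≡ p b
  agree′ pa pb = trans (sym (not-involutive _)) (trans (cong not (trans pa (sym pb))) (not-involutive _))
  separated : Σ (Fin (V G)) λ u → Σ (Fin (V G)) λ v → ¬ Reach (RemAdj G F) u v
  -- As `h` is positive, each side has a vertex.
  separated with ≤card⇒injection p (≤-trans 1≤h h≤) | ≤card⇒injection (not ∘ p) (≤-trans 1≤h h≤′)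
  ... | g , _ , pg | g′ , _ , pg′ = g zero , g′ zero , λ u⇝v →
    contradiction (trans (cong not (trans (sym (pg zero)) (reach-closed p (same-side (adj G _ _)) u⇝v))) (pg′ zero)) λ ()
  large : ∀ v → Σ (Fin h → Fin (V G)) λ g → Injective _≡_ _≡_ g × (∀ i → Reach (RemAdj G F) v (g i))
  large v with p v in pv
  ... | true  with ≤card⇒injection p h≤
  ...   | g , g-injective , pg = g , g-injective , λ i →
    reach-map id (inside agree) (conn v (g i) pv (pg i))
  large v | false with ≤card⇒injection (not ∘ p) h≤′
  ...   | g , g-injective , pg = g , g-injective , λ i →
    reach-map id (inside agree′) (conn′ v (g i) (cong not pv) (pg i))

does-true : ∀ {A : Set} (d : Dec A) → does d ≡ true → A
does-true (yes a) _ = a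

-- The inequality this serves is decidable, hence stable, so reachability may be decided classically.
extraCut-side : ∀ {G h} (F : EdgeSet G) → Symmetric G → IsExtraCut h G F →
  ¬ ¬ (∃ λ p → h ≤ card p × h ≤ card (not ∘ p) × cut G p ≤ edgeSetSize F)
extraCut-side {G} {h} F symG ((u , v , u⇝̸v) , large) ¬side =
  -- Double negation commutes with the finite product over the vertices, so all instances of
  -- excluded middle are available together.
  sequence (RawMonad.rawApplicative ¬¬-Monad) (λ x → ¬¬-excluded-middle {A = Reach (RemAdj G F) u x}) (¬side ∘ side)
  where
  side : (∀ x → Dec (Reach (RemAdj G F) u x)) →
    ∃ λ p → h ≤ card p × h ≤ card (not ∘ p) × cut G p ≤ edgeSetSize F
  -- `p` is the component of `u`, and its complement contains the component of `v`; both components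
  -- have at least `h` vertices.
  side reach? = p , many u (λ u⇝x → dec-true (reach? _) u⇝x) ,
    many v (λ v⇝x → cong not (dec-false (reach? _) λ u⇝x →
      u⇝̸v (reach-trans u⇝x (reach-sym (remAdj-sym symG F) v⇝x)))) ,
    subst (_≤ edgeSetSize F) (boundary-size G symG p) (edgeSetSize-mono {E = boundary G symG p} {F = F} cuts)
    where
    p : Fin (V G) → Bool
    p x = does (reach? x)
    many : ∀ w {q : Fin (V G) → Bool} → (∀ {x} → Reach (RemAdj G F) w x → q x ≡ true) → h ≤ card q
    many w {q} reached with large w
    ... | g , g-injective , w⇝g = injection⇒≤card q g g-injective (reached ∘ w⇝g)
    closed : ∀ {a b} → RemAdj G F a b → p a ≡ true → p b ≡ true
    closed {a} {b} e pa = dec-true (reach? b) (reach-trans (does-true (reach? a) pa) (there e here))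
    -- A crossing edge outside `F` would survive and extend the component of `u` past `p`.
    cuts : ∀ a b → adj G a b ∧ (p a xor p b) ≡ true → mem F a b ≡ true
    cuts a b crossing with adj G a b in ab | mem F a b in Fab
    ... | true | true  = refl
    ... | true | false with p a in pa | p b in pb
    ...   | true  | false = trans (sym pb) (closed (cong₂ (λ x y → x ∧ not y) ab Fab) pa)
    ...   | false | true  = trans (sym pa)
      (closed (remAdj-sym symG F (cong₂ (λ x y → x ∧ not y) ab Fab)) pb)

-- As `IsLambda` and `IsXi` are relations, equality is expressed by a common value, here
-- `θ (suc K) h` with `n = 3 + K`. The bound on `h` is additive to avoid truncated subtraction, with
-- `n % 2` as the parity term.
theorem1 : ∀ (n : ℕ) → 3 ≤ n → (H : Graph) → K4Hypercube n H →
    ∀ (h : ℕ) → 1 ≤ h → h + 2 + n % 2 ≤ 2 ^ ⌈ n /2⌉ →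
    ∃ λ k → IsLambda H h k × IsXi H h k
theorem1 (suc (suc (suc K))) (s≤s (s≤s (s≤s z≤n))) H hyp h 1≤h hb =
  conclude (attained E h (≤-trans h≤T (m≤m+n (cube K) (cube K))))
  where
  E : Extremal (suc K) H
  E = extremal (suc K) hyp

  h≤T : h ≤ cube K
  h≤T = begin
    h                        ≤⟨ m≤m+n h 2 ⟩
    h + 2                    ≤⟨ m≤m+n (h + 2) _ ⟩
    h + 2 + (3 + K) % 2      ≤⟨ hb ⟩
    -- That is `⌈n/2⌉ ≤ n - 1`, so `h` is at most half the order.
    2 ^ suc ⌈ suc K /2⌉      ≤⟨ ^-monoʳ-≤ 2 (s≤s (⌈n/2⌉≤n (suc K))) ⟩
    2 ^ (2 + K)              ≡⟨ cube≡2^ K ⟨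
    cube K                   ∎
    where open ≤-Reasoning

  card-complement : ∀ p → card p + card (not ∘ p) ≡ cube K + cube K
  card-complement p = trans (card-not p) (order E)

  cut-bound : ∀ p → h ≤ card p → h ≤ card (not ∘ p) → θ (suc K) h ≤ cut H p
  -- Monotonicity is applied to whichever side has at most half the vertices; both sides have the
  -- same cut.
  cut-bound p h≤ h≤′ with ≤-total (card p) (cube K)
  ... | inj₁ p≤T = ≤-trans (θ-mono-range K hb h≤ p≤T) (lower E p)
  ... | inj₂ T≤p = subst (θ (suc K) h ≤_) (cut-not H (symmetric E) p)
    (≤-trans (θ-mono-range K hb h≤′ p′≤T) (lower E (not ∘ p)))
    where
    p′≤T : card (not ∘ p) ≤ cube K
    p′≤T = +-cancelˡ-≤ (cube K) _ _ (≤-trans (+-monoˡ-≤ _ T≤p) (≤-reflexive (card-complement p)))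

  conclude : (∃ λ p → card p ≡ h × cut H p ≡ θ (suc K) h × Connected H p × Connected H (not ∘ p)) →
    ∃ λ k → IsLambda H h k × IsXi H h k
  conclude (p , card≡ , cut≡ , conn , conn′) = θ (suc K) h ,
    ( (boundary H (symmetric E) p ,
        boundary-isExtraCut (symmetric E) 1≤h p (≤-reflexive (sym card≡)) h≤′ conn conn′ ,
        trans (boundary-size H (symmetric E) p) cut≡)
    , λ F isCut → decidable-stable (θ (suc K) h ≤? edgeSetSize F) λ ¬bound →
        extraCut-side F (symmetric E) isCut λ (q , h≤q , h≤q′ , cut≤) → ¬bound (≤-trans (cut-bound q h≤q h≤q′) cut≤))
    , ( (X , trans (∣∣≡card X) (trans (sum-cong-≗ λ x → cong ind (X≗p x)) card≡) ,
          Connected⇒Induced H X X≗p conn ,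
          Connected⇒Induced H (∁ X) (λ x → trans (lookup-map x not X) (cong not (X≗p x))) conn′ ,
          trans (cutSize≡cut H X) (trans (cut-cong H X≗p) cut≡))
      , λ Y ∣Y∣≡h _ _ → subst₂ (λ m c → θ (suc K) m ≤ c)
          (trans (sym (∣∣≡card Y)) ∣Y∣≡h) (sym (cutSize≡cut H Y)) (lower E (lookup Y)))
    where
    X : Subset (V H)
    X = tabulate p
    X≗p : ∀ x → lookup X x ≡ p x
    X≗p = lookup∘tabulate p
    h≤′ : h ≤ card (not ∘ p)
    h≤′ = +-cancelˡ-≤ h _ _ (begin
      h + h                 ≤⟨ +-mono-≤ h≤T h≤T ⟩
      cube K + cube K       ≡⟨ card-complement p ⟨
      card p + card (not ∘ p) ≡⟨ cong (_+ card (not ∘ p)) card≡ ⟩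
      h + card (not ∘ p)    ∎)
      where open ≤-Reasoning
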